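{- Let $v,w\in S_n$ be such that $v\le w$ and $w$ is $k$-Grassmannian. Let $\mathbf{x_w}$ be a reduced word for $x_w$, let $\mathbf w$ be a reduced word for $w$, and let $\mathbf{x_w}\mathbf w=(s_{i_1},s_{i_2},\dots)$ be their concatenation. Then for every $x_wv$-subword $\mathbf u=(u_1,u_2,\dots)$ of $\mathbf{x_w}\mathbf{w}$, we have $u_j=s_{i_j}$ for $1\le j\le\ell(x_w)$.
   Context: Let $n\ge2$, $0\le k\le n$. $\tilde S_n$ is the group of bijections $f:\mathbb{Z}\to\mathbb{Z}$ with $f(i+n)=f(i)+n$, with products read left to right, $(fg)(a)=g(f(a))$. $\tilde S_n^{(k)}$ is the subset with $\frac1n\sum_{i=1}^n(f(i)-i)=k$. Length: $\ell(f)=\#\{(a,b):1\le a\le n,\ b\in\mathbb{Z},\ a<b,\ f(a)>f(b)\}$. $s_i$ ($0\le i\le n-1$) exchanges $i+mn$ and $i+1+mn$ for all $m$ and fixes all other integers. $\Lambda(i)=i+1$. $S_n=\langle s_1,\dots,s_{n-1}\rangle\subset\tilde S_n$ via periodic extension; $\le$ is Bruhat order on $S_n$. A word is a finite sequence $\mathbf g=(s_{i_1},\dots,s_{i_m})$ of elements of $\{s_0,\dots,s_{n-1}\}$. A reduced word for $f\in\tilde S_n^{(k)}$ is a reduced word for $\Lambda^{ -k}f\in\tilde S_n^{(0)}$, i.e. $s_{i_1}\cdots s_{i_m}=\Lambda^{ -k}f$ with $m=\ell(f)$ (for $w\in S_n$ take $k=0$, the usual notion). A subword of $\mathbf g$ is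 a sequence $\mathbf u=(u_1,\dots,u_m)$ with $u_j\in\{s_{i_j},e\}$; for $f\in\tilde S_n^{(k)}$ it is an $f$-subword if $u_1\cdots u_m=\Lambda^{ -k}f$. A permutation $w\in S_n$ is $k$-Grassmannian if $w(1)<\dots<w(k)$ and $w(k+1)<\dots<w(n)$. $\tau_{k,n}\in\tilde S_n^{(k)}$ is given by $\tau_{k,n}(i)=i+n$ for $1\le i\le k$ and $\tau_{k,n}(i)=i$ for $k+1\le i\le n$; and $x_w:=w^{ -1}\tau_{k,n}\in\tilde S_n^{(k)}$. -}

module Defs where

open import Algebra.Bundles using (Group)
import Algebra.Definitions.RawMonoid as RawMonoidDefinitions
open import Data.Bool using (if_then_else_)
open import Data.Fin using (Fin; toℕ)
open import Data.Fin.Properties using (any?)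
open import Data.Integer using (ℤ; +_; 1ℤ; _+_; _-_; _≤_; _<_)
open import Data.Integer.Divisibility.Signed using (_∣_; _∣?_; ∣-refl; ∣m∣n⇒∣m+n; ∣m∣n⇒∣m-n; ∣⇒∣ᵤ)
open import Data.Integer.Tactic.RingSolver using (solve-∀)
open import Data.List using (List; foldr; length; lookup)
open import Data.Nat as ℕ using (ℕ)
import Data.Nat.Divisibility as ℕ
import Data.Nat.Properties as ℕ
open import Data.Product using (Σ; ∃; ∃₂; _×_; _,_)
open import Data.Sum using (_⊎_)
open import Data.Vec.Functional using (Vector)
open import Function using (_∘_)
open import Function.Bundles using (_↔_; Inverse; mk↔ₛ′)
open import Function.Construct.Composition using (_↔-∘_)
open import Function.Construct.Identity using (↔-id)
open import Function.Construct.Symmetry using (↔-sym)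
open import Relation.Binary.Construct.Closure.ReflexiveTransitive using (Star)
open import Relation.Binary.Construct.Union using (_∪_)
open import Relation.Binary.PropositionalEquality using (_≡_; refl; sym; trans; cong; subst; module ≡-Reasoning)
open import Relation.Nullary using (¬_; Dec; does; yes; no)
open import Relation.Nullary.Decidable using (dec-true; dec-false)

module Affine (n : ℕ) (2≤n : 2 ℕ.≤ n) where

  infix 4 _≡ₙ_ _≡ₙ?_

  _≡ₙ_ : ℤ → ℤ → Set
  a ≡ₙ b = + n ∣ a - b

  _≡ₙ?_ : ∀ a b → Dec (a ≡ₙ b)
  a ≡ₙ? b = + n ∣? (a - b)

  record AffinePermutation : Set where
    field
      bijection : ℤ ↔ ℤ
    open Inverse bijection public using (to; from; strictlyInverseˡ; strictlyInverseʳ)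
    field
      periodic : ∀ a → to (a + + n) ≡ to a + + n

  open AffinePermutation

  infixl 20 _⟨$⟩_
  _⟨$⟩_ : AffinePermutation → ℤ → ℤ
  f ⟨$⟩ a = to f a

  infix 4 _≈_
  _≈_ : AffinePermutation → AffinePermutation → Set
  f ≈ g = ∀ a → f ⟨$⟩ a ≡ g ⟨$⟩ a

  -- Products are read left to right: (f ∙ g)(a) = g(f(a)).
  infixl 7 _∙_
  _∙_ : AffinePermutation → AffinePermutation → AffinePermutation
  f ∙ g = record
    { bijection = bijection g ↔-∘ bijection f
    ; periodic  = λ a → trans (cong (to g) (periodic f a)) (periodic g (to f a))
    }

  ε : AffinePermutation
  ε = record { bijection = ↔-id ℤ ; periodic = λ _ → refl }

  infix 8 _⁻¹
  _⁻¹ : AffinePermutation → AffinePermutation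
  f ⁻¹ = record
    { bijection = ↔-sym (bijection f)
    ; periodic  = λ a → begin
        from f (a + + n)                   ≡⟨ cong (λ b → from f (b + + n)) (strictlyInverseˡ f a) ⟨
        from f (to f (from f a) + + n)     ≡⟨ cong (from f) (periodic f (from f a)) ⟨
        from f (to f (from f a + + n))     ≡⟨ strictlyInverseʳ f _ ⟩
        from f a + + n                     ∎
    }
    where open ≡-Reasoning

  affineGroup : Group _ _
  affineGroup = record
    { Carrier = AffinePermutation
    ; _≈_     = _≈_
    ; _∙_     = _∙_
    ; ε       = ε
    ; _⁻¹     = _⁻¹
    ; isGroup = record
      { isMonoid = record
        { isSemigroup = record
          { isMagma = record
            { isEquivalence = record
              { refl  = λ _ → refl
              ; sym   = λ p a → sym (p a)
              ; trans = λ p q a → trans (p a) (q a)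
              }
            ; ∙-cong = λ {f} {f′} {g} p q a → trans (cong (to g) (p a)) (q (to f′ a))
            }
          ; assoc = λ _ _ _ _ → refl
          }
        ; identity = (λ _ _ → refl) , (λ _ _ → refl)
        }
      ; inverse = strictlyInverseˡ , strictlyInverseʳ
      ; ⁻¹-cong = λ {f} {g} p a → begin
          from f a                      ≡⟨ cong (from f) (strictlyInverseˡ g a) ⟨
          from f (to g (from g a))      ≡⟨ cong (from f) (p (from g a)) ⟨
          from f (to f (from g a))      ≡⟨ strictlyInverseʳ f _ ⟩
          from g a                      ∎
      }
    }
    where open ≡-Reasoning

  -- The library's additive names: m ×ᴹ f is the power fᵐ, and the "sum" of a
  -- vector (u₁ , … , uₘ) is the product u₁ ⋯ uₘ.
  open RawMonoidDefinitions (Group.rawMonoid affineGroup) using ()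
    renaming (_×_ to _×ᴹ_; sum to ∏) public

  infixr 9 _^_
  _^_ : AffinePermutation → ℕ → AffinePermutation
  f ^ m = m ×ᴹ f

  Λ : AffinePermutation
  Λ = record
    { bijection = mk↔ₛ′ (_+ 1ℤ) (_- 1ℤ) -1+1 +1-1
    ; periodic  = λ a → +n+1 a (+ n)
    }
    where
    -1+1 : ∀ a → a - 1ℤ + 1ℤ ≡ a
    -1+1 = solve-∀
    +1-1 : ∀ a → a + 1ℤ - 1ℤ ≡ a
    +1-1 = solve-∀
    +n+1 : ∀ a m → a + m + 1ℤ ≡ a + 1ℤ + m
    +n+1 = solve-∀

  n∤1 : ¬ (+ n ∣ 1ℤ)
  n∤1 p = ℕ.<⇒≱ 2≤n (ℕ.∣⇒≤ (∣⇒∣ᵤ p))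

  ≡ₙ-+n : ∀ a b → a ≡ₙ b → a + + n ≡ₙ b
  ≡ₙ-+n a b p = subst (+ n ∣_) (eq a b (+ n)) (∣m∣n⇒∣m+n p ∣-refl)
    where
    eq : ∀ a b m → (a - b) + m ≡ (a + m) - b
    eq = solve-∀

  ≡ₙ--n : ∀ a b → a + + n ≡ₙ b → a ≡ₙ b
  ≡ₙ--n a b p = subst (+ n ∣_) (eq a b (+ n)) (∣m∣n⇒∣m-n p ∣-refl)
    where
    eq : ∀ a b m → (a + m - b) - m ≡ a - b
    eq = solve-∀

  swap : ℤ → ℤ → ℤ
  swap i a = if does (a ≡ₙ? i)        then a + 1ℤ
        else if does (a ≡ₙ? (i + 1ℤ)) then a - 1ℤ
        else a

  ≡ₙ-exclusive : ∀ i a → a ≡ₙ i + 1ℤ → ¬ (a ≡ₙ i)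
  ≡ₙ-exclusive i a p q = n∤1 (subst (+ n ∣_) (eq a i) (∣m∣n⇒∣m-n q p))
    where
    eq : ∀ a i → (a - i) - (a - (i + 1ℤ)) ≡ 1ℤ
    eq = solve-∀

  swap-up : ∀ i a → a ≡ₙ i → swap i a ≡ a + 1ℤ
  swap-up i a p rewrite dec-true (a ≡ₙ? i) p = refl

  swap-down : ∀ i a → a ≡ₙ i + 1ℤ → swap i a ≡ a - 1ℤ
  swap-down i a p
    rewrite dec-false (a ≡ₙ? i) (≡ₙ-exclusive i a p)
          | dec-true (a ≡ₙ? (i + 1ℤ)) p = refl

  swap-fix : ∀ i a → ¬ (a ≡ₙ i) → ¬ (a ≡ₙ i + 1ℤ) → swap i a ≡ a
  swap-fix i a p q
    rewrite dec-false (a ≡ₙ? i) p | dec-false (a ≡ₙ? (i + 1ℤ)) q = refl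

  swap-involutive : ∀ i a → swap i (swap i a) ≡ a
  swap-involutive i a with a ≡ₙ? i | a ≡ₙ? (i + 1ℤ)
  ... | yes p | _     = trans (cong (swap i) (swap-up i a p))
    (trans (swap-down i (a + 1ℤ) (subst (+ n ∣_) (eq a i) p)) (eq′ a))
    where
    eq : ∀ a i → a - i ≡ (a + 1ℤ) - (i + 1ℤ)
    eq = solve-∀
    eq′ : ∀ a → a + 1ℤ - 1ℤ ≡ a
    eq′ = solve-∀
  ... | no _  | yes q = trans (cong (swap i) (swap-down i a q))
    (trans (swap-up i (a - 1ℤ) (subst (+ n ∣_) (eq a i) q)) (eq′ a))
    where
    eq : ∀ a i → a - (i + 1ℤ) ≡ (a - 1ℤ) - i
    eq = solve-∀
    eq′ : ∀ a → a - 1ℤ + 1ℤ ≡ a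
    eq′ = solve-∀
  ... | no p  | no q  = trans (cong (swap i) (swap-fix i a p q)) (swap-fix i a p q)

  swap-periodic : ∀ i a → swap i (a + + n) ≡ swap i a + + n
  swap-periodic i a with a ≡ₙ? i | a ≡ₙ? (i + 1ℤ)
  ... | yes p | _     = trans (swap-up i (a + + n) (≡ₙ-+n a i p))
    (trans (eq a (+ n)) (cong (_+ + n) (sym (swap-up i a p))))
    where
    eq : ∀ a m → a + m + 1ℤ ≡ a + 1ℤ + m
    eq = solve-∀
  ... | no _  | yes q = trans (swap-down i (a + + n) (≡ₙ-+n a (i + 1ℤ) q))
    (trans (eq a (+ n)) (cong (_+ + n) (sym (swap-down i a q))))
    where
    eq : ∀ a m → a + m - 1ℤ ≡ a - 1ℤ + m
    eq = solve-∀
  ... | no p  | no q  = trans (swap-fix i (a + + n) (p ∘ ≡ₙ--n a i) (q ∘ ≡ₙ--n a (i + 1ℤ)))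
    (cong (_+ + n) (sym (swap-fix i a p q)))

  s : Fin n → AffinePermutation
  s i = record
    { bijection = mk↔ₛ′ (swap ι) (swap ι) (swap-involutive ι) (swap-involutive ι)
    ; periodic  = swap-periodic ι
    }
    where
    ι : ℤ
    ι = + toℕ i

  -- S_n, the subgroup of the affine group generated by s₁ , … , sₙ₋₁.
  data InSₙ : AffinePermutation → Set where
    gen  : ∀ {i} → 1 ℕ.≤ toℕ i → InSₙ (s i)
    unit : InSₙ ε
    mul  : ∀ {f g} → InSₙ f → InSₙ g → InSₙ (f ∙ g)
    inv  : ∀ {f} → InSₙ f → InSₙ (f ⁻¹)
    resp : ∀ {f g} → f ≈ g → InSₙ f → InSₙ g

  Inversion : AffinePermutation → Set
  Inversion f = Σ (ℤ × ℤ) λ (a , b) →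
    (1ℤ ≤ a × a ≤ + n) × a < b × f ⟨$⟩ b < f ⟨$⟩ a

  -- ℓ(f) = m.  The order relations on ℤ are proof-irrelevant, so Inversion f
  -- has exactly one element for each pair (a , b) being counted.
  HasLength : AffinePermutation → ℕ → Set
  HasLength f m = Inversion f ↔ Fin m

  -- Reflections of the Coxeter group S_n: the S_n-conjugates of s₁ , … , sₙ₋₁.
  IsReflection : AffinePermutation → Set
  IsReflection t = ∃₂ λ u i → InSₙ u × 1 ℕ.≤ toℕ i × t ≈ u ∙ s i ∙ u ⁻¹

  infix 4 _⟶_ _≤ᴮ_

  _⟶_ : AffinePermutation → AffinePermutation → Set
  v ⟶ w = (∃ λ t → IsReflection t × w ≈ v ∙ t)
        × (∃₂ λ l m → HasLength v l × HasLength w m × l ℕ.< m)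

  -- Bruhat order on S_n (to be used between elements of S_n).  The step _≈_
  -- only accounts for equality of permutations being a setoid equality.
  _≤ᴮ_ : AffinePermutation → AffinePermutation → Set
  _≤ᴮ_ = Star (_≈_ ∪ _⟶_)

  -- The letter i stands for sᵢ.
  Word : Set
  Word = List (Fin n)

  ⟦_⟧ : Word → AffinePermutation
  ⟦_⟧ = foldr (λ i f → s i ∙ f) ε

  -- The remaining notions for f ∈ S̃ₙ⁽ᵏ⁾ carry k explicitly.  Since every sᵢ
  -- lies in S̃ₙ⁽⁰⁾, the product equations below already force f ∈ S̃ₙ⁽ᵏ⁾.
  IsReducedWord : ℕ → AffinePermutation → Word → Set
  IsReducedWord k f g = ⟦ g ⟧ ≈ (Λ ^ k) ⁻¹ ∙ f × HasLength f (length g)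

  IsSubword : (g : Word) → Vector AffinePermutation (length g) → Set
  IsSubword g u = ∀ j → u j ≈ s (lookup g j) ⊎ u j ≈ ε

  IsSubwordFor : ℕ → AffinePermutation → (g : Word) → Vector AffinePermutation (length g) → Set
  IsSubwordFor k f g u = IsSubword g u × ∏ u ≈ (Λ ^ k) ⁻¹ ∙ f

  IsGrassmannian : ℕ → AffinePermutation → Set
  IsGrassmannian k w =
      (∀ a b → 1ℤ ≤ a → a < b → b ≤ + k → w ⟨$⟩ a < w ⟨$⟩ b)
    × (∀ a b → + k + 1ℤ ≤ a → a < b → b ≤ + n → w ⟨$⟩ a < w ⟨$⟩ b)

  -- a is congruent modulo n to one of 1 , … , k.
  InFirst : ℕ → ℤ → Set
  InFirst k a = ∃ λ (j : Fin k) → a ≡ₙ + (1 ℕ.+ toℕ j)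

  inFirst? : ∀ k a → Dec (InFirst k a)
  inFirst? k a = any? λ j → a ≡ₙ? (+ (1 ℕ.+ toℕ j))

  inFirst-+n : ∀ k a → InFirst k a → InFirst k (a + + n)
  inFirst-+n k a (j , p) = j , ≡ₙ-+n a _ p

  inFirst--n : ∀ k a → InFirst k (a + + n) → InFirst k a
  inFirst--n k a (j , p) = j , ≡ₙ--n a _ p

  -n+n : ∀ a m → a - m + m ≡ a
  -n+n = solve-∀

  +n-n : ∀ a m → a + m - m ≡ a
  +n-n = solve-∀

  shift shift⁻¹ : ℕ → ℤ → ℤ
  shift   k a = if does (inFirst? k a) then a + + n else a
  shift⁻¹ k a = if does (inFirst? k a) then a - + n else a

  shift-in : ∀ k a → InFirst k a → shift k a ≡ a + + n
  shift-in k a p rewrite dec-true (inFirst? k a) p = refl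

  shift-out : ∀ k a → ¬ InFirst k a → shift k a ≡ a
  shift-out k a p rewrite dec-false (inFirst? k a) p = refl

  shift⁻¹-in : ∀ k a → InFirst k a → shift⁻¹ k a ≡ a - + n
  shift⁻¹-in k a p rewrite dec-true (inFirst? k a) p = refl

  shift⁻¹-out : ∀ k a → ¬ InFirst k a → shift⁻¹ k a ≡ a
  shift⁻¹-out k a p rewrite dec-false (inFirst? k a) p = refl

  shift-shift⁻¹ : ∀ k a → shift k (shift⁻¹ k a) ≡ a
  shift-shift⁻¹ k a with inFirst? k a
  ... | yes p = trans
    (shift-in k (a - + n) (inFirst--n k (a - + n) (subst (InFirst k) (sym (-n+n a (+ n))) p)))
    (-n+n a (+ n))
  ... | no p  = shift-out k a p

  shift⁻¹-shift : ∀ k a → shift⁻¹ k (shift k a) ≡ a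
  shift⁻¹-shift k a with inFirst? k a
  ... | yes p = trans (shift⁻¹-in k (a + + n) (inFirst-+n k a p)) (+n-n a (+ n))
  ... | no p  = shift⁻¹-out k a p

  shift-periodic : ∀ k a → shift k (a + + n) ≡ shift k a + + n
  shift-periodic k a with inFirst? k a
  ... | yes p = shift-in k (a + + n) (inFirst-+n k a p)
  ... | no p  = shift-out k (a + + n) (p ∘ inFirst--n k a)

  -- τ_{k,n}, for 0 ≤ k ≤ n.
  τ : ℕ → AffinePermutation
  τ k = record
    { bijection = mk↔ₛ′ (shift k) (shift⁻¹ k) (shift-shift⁻¹ k) (shift⁻¹-shift k)
    ; periodic  = shift-periodic k
    }

  -- x_w = w⁻¹ τ_{k,n}.
  x : ℕ → AffinePermutation → AffinePermutation
  x k w = w ⁻¹ ∙ τ k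

{-# OPTIONS --safe #-}
-- The element x_w has minimal length in its coset x_w S_n: its inverse sends
-- j ≤ k to w(j) - n ≤ 0 and j > k to w(j) > 0, and w is k-Grassmannian, so it
-- is increasing on 1, …, n.  Hence x_w inverts only pairs whose images lie in
-- different windows mn+1, …, mn+n, and every pair inverted by x_w is inverted
-- by x_w z for each z ∈ S_n.
--
-- In a subword u of 𝐱𝐰 for x_w v, the part y taken from 𝐰 lies in S_n, because
-- a reduced word of an element of S_n avoids s₀.  The part taken from 𝐱 is thus
-- Λ⁻ᵏ x_w z with z = v y⁻¹ ∈ S_n, which needs at least ℓ(x_w) letters.
module Submission where

open import Defs
open import Data.Nat using (ℕ; _≤_; _<_)
open import Data.Fin using (Fin; toℕ)
open import Data.List using (length; lookup; _++_)
open import Data.Vec.Functional using (Vector)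

open import Data.Empty using (⊥; ⊥-elim)
open import Data.Fin using (zero; suc; fromℕ<)
open import Data.Fin.Permutation using (↔⇒≡)
open import Data.Fin.Properties using (injective⇒≤; toℕ<n; suc-injective; toℕ-fromℕ<)
open import Data.Integer using (ℤ; +_; +[1+_]; -[1+_]; 0ℤ; 1ℤ; _+_; _-_; _*_; -_; +≤+; -≤+; +<+) renaming (_≤_ to _≤ᶻ_; _<_ to _<ᶻ_; suc to sucᶻ)
open import Data.Integer.Divisibility.Signed using (divides; ∣⇒∣ᵤ)
open import Data.Integer.DivMod using (_/ℕ_; [n/ℕd]*d≤n; n<s[n/ℕd]*d)
import Data.Integer.Properties as ℤ
open import Data.Integer.Tactic.RingSolver using (solve-∀)
open import Data.List using ([]; _∷_)
open import Data.List.Relation.Unary.All using (All; []; _∷_)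
import Data.Nat as ℕ
import Data.Nat.Divisibility as ℕ
import Data.Nat.Properties as ℕ
open import Data.Product using (∃-syntax; _×_; _,_; proj₁; proj₂)
open import Data.Sum using (_⊎_; inj₁; inj₂)
open import Data.Unit using (⊤; tt)
open import Function using (_∘_)
open import Function.Bundles using (Inverse)
open import Function.Construct.Composition using (_↔-∘_)
open import Function.Construct.Symmetry using (↔-sym)
open import Relation.Binary.Definitions using (tri<; tri≈; tri>)
open import Relation.Binary.PropositionalEquality using (_≡_; refl; sym; trans; cong; cong₂; subst; subst₂)
open import Relation.Nullary using (¬_; yes; no)

-- Strict and weak inequalities between integers.

<⇒+1≤ : ∀ {a b} → a <ᶻ b → a + 1ℤ ≤ᶻ b
<⇒+1≤ {a} p = subst (_≤ᶻ _) (ℤ.+-comm 1ℤ a) (ℤ.i<j⇒suc[i]≤j p)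

+1≤⇒< : ∀ {a b} → a + 1ℤ ≤ᶻ b → a <ᶻ b
+1≤⇒< {a} p = ℤ.suc[i]≤j⇒i<j (subst (_≤ᶻ _) (ℤ.+-comm a 1ℤ) p)

+1-1 : ∀ a → a + 1ℤ - 1ℤ ≡ a
+1-1 = solve-∀

-1+1 : ∀ a → a - 1ℤ + 1ℤ ≡ a
-1+1 = solve-∀

<⇒≤-1 : ∀ {a b} → a <ᶻ b → a ≤ᶻ b - 1ℤ
<⇒≤-1 {a} p = subst (_≤ᶻ _) (+1-1 a) (ℤ.+-monoˡ-≤ (- 1ℤ) (<⇒+1≤ p))

≤-1⇒< : ∀ {a b} → a ≤ᶻ b - 1ℤ → a <ᶻ b
≤-1⇒< {b = b} p = +1≤⇒< (subst (_ ≤ᶻ_) (-1+1 b) (ℤ.+-monoˡ-≤ 1ℤ p))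

a<a+1 : ∀ a → a <ᶻ a + 1ℤ
a<a+1 a = +1≤⇒< ℤ.≤-refl

a-1<a : ∀ a → a - 1ℤ <ᶻ a
a-1<a a = ≤-1⇒< ℤ.≤-refl

module _ {n : ℕ} {2≤n : 2 ≤ n} where
  open Affine n 2≤n
  open AffinePermutation

  private instance
    n≢0 : ℕ.NonZero n
    n≢0 = ℕ.>-nonZero (ℕ.<-trans ℕ.z<s 2≤n)

  -- Windows

  -- f maps each window mn+1, …, mn+n onto itself.
  Preserving : AffinePermutation → Set
  Preserving f = ∀ m a → (a ≤ᶻ m * + n → f ⟨$⟩ a ≤ᶻ m * + n)
                       × (f ⟨$⟩ a ≤ᶻ m * + n → a ≤ᶻ m * + n)

  preserving-> : ∀ f → Preserving f → ∀ m {a} → m * + n <ᶻ a → m * + n <ᶻ f ⟨$⟩ a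
  preserving-> f pf m {a} lt = ℤ.≰⇒> λ le → ℤ.<⇒≱ lt (proj₂ (pf m a) le)

  ε-preserving : Preserving ε
  ε-preserving m a = (λ le → le) , (λ le → le)

  ∙-preserving : ∀ {f g} → Preserving f → Preserving g → Preserving (f ∙ g)
  ∙-preserving {f} pf pg m a =
    proj₁ (pg m (f ⟨$⟩ a)) ∘ proj₁ (pf m a) , proj₂ (pf m a) ∘ proj₂ (pg m (f ⟨$⟩ a))

  ≈-preserving : ∀ {f g} → f ≈ g → Preserving f → Preserving g
  ≈-preserving f≈g pf m a rewrite sym (f≈g a) = pf m a

  ⁻¹-preserving : ∀ {f} → Preserving f → Preserving (f ⁻¹)
  ⁻¹-preserving {f} pf m a =
      (λ le → proj₂ (pf m (from f a)) (subst (_≤ᶻ m * + n) (sym (strictlyInverseˡ f a)) le))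
    , (λ le → subst (_≤ᶻ m * + n) (strictlyInverseˡ f a) (proj₁ (pf m (from f a)) le))

  -- Since 0 < i < n, the number i is no multiple of n. Hence s_i with i ≥ 1 never exchanges mn and
  -- mn + 1.
  n∤toℕ : ∀ (i : Fin n) → 1 ≤ toℕ i → ∀ m → ¬ (m * + n ≡ₙ + toℕ i)
  n∤toℕ i 1≤i m (divides q eq) =
    ℕ.<⇒≱ (toℕ<n i) (ℕ.∣⇒≤ {{ℕ.>-nonZero 1≤i}} (∣⇒∣ᵤ (divides (m - q) eq′)))
    where
    lem : ∀ x y z → x * z - (x * z - y) ≡ y
    lem = solve-∀
    lem′ : ∀ x y z → x * z - y * z ≡ (x - y) * z
    lem′ = solve-∀
    eq′ : + toℕ i ≡ (m - q) * + n
    eq′ = trans (sym (lem m (+ toℕ i) (+ n)))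
                (trans (cong (λ c → m * + n - c) eq) (lem′ m q (+ n)))

  -- `up` records its congruence because upward moves have to be located, both at a window boundary
  -- and in a reversed pair.
  data SwapView (i a : ℤ) : ℤ → Set where
    up   : a ≡ₙ i → SwapView i a (a + 1ℤ)
    down : SwapView i a (a - 1ℤ)
    fix  : SwapView i a a

  swap-view : ∀ i a → SwapView i a (swap i a)
  swap-view i a with a ≡ₙ? i | a ≡ₙ? (i + 1ℤ)
  ... | yes p | _     = subst (SwapView i a) (sym (swap-up i a p)) (up p)
  ... | no _  | yes q = subst (SwapView i a) (sym (swap-down i a q)) down
  ... | no p  | no q  = subst (SwapView i a) (sym (swap-fix i a p q)) fix

  -- Only an upward move starting at mn itself could cross the bound, and mn is not congruent to i.
  swap-≤ : ∀ (i : Fin n) → 1 ≤ toℕ i → ∀ m a → a ≤ᶻ m * + n → swap (+ toℕ i) a ≤ᶻ m * + n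
  swap-≤ i 1≤i m a le with swap (+ toℕ i) a | swap-view (+ toℕ i) a
  ... | _ | up p = <⇒+1≤ (ℤ.≤∧≢⇒< le λ a≡mn → n∤toℕ i 1≤i m (subst (_≡ₙ + toℕ i) a≡mn p))
  ... | _ | down = ℤ.<⇒≤ (ℤ.<-≤-trans (a-1<a a) le)
  ... | _ | fix  = le

  s-preserving : ∀ i → 1 ≤ toℕ i → Preserving (s i)
  s-preserving i 1≤i m a =
      swap-≤ i 1≤i m a
    , λ le → subst (_≤ᶻ m * + n) (swap-involutive (+ toℕ i) a) (swap-≤ i 1≤i m _ le)

  Sₙ-preserving : ∀ {f} → InSₙ f → Preserving f
  Sₙ-preserving (gen {i} 1≤i)        = s-preserving i 1≤i
  Sₙ-preserving unit                 = ε-preserving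
  Sₙ-preserving (mul {f} {g} pf pg)  = ∙-preserving {f} {g} (Sₙ-preserving pf) (Sₙ-preserving pg)
  Sₙ-preserving (inv {f} pf)         = ⁻¹-preserving {f} (Sₙ-preserving pf)
  Sₙ-preserving (resp {f} {g} eq pf) = ≈-preserving {f} {g} eq (Sₙ-preserving pf)

  periodic-ℕ : ∀ f a j → f ⟨$⟩ (a + + j * + n) ≡ f ⟨$⟩ a + + j * + n
  periodic-ℕ f a ℕ.zero    = trans (cong (to f) (ℤ.+-identityʳ a)) (sym (ℤ.+-identityʳ _))
  periodic-ℕ f a (ℕ.suc j) =
    trans (cong (to f) (lem a (+ j) (+ n)))
    (trans (periodic f _)
    (trans (cong (_+ + n) (periodic-ℕ f a j)) (sym (lem (f ⟨$⟩ a) (+ j) (+ n)))))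
    where
    lem : ∀ a j m → a + (1ℤ + j) * m ≡ a + j * m + m
    lem = solve-∀

  periodic-ℤ : ∀ f a m → f ⟨$⟩ (a + m * + n) ≡ f ⟨$⟩ a + m * + n
  periodic-ℤ f a (+ j)    = periodic-ℕ f a j
  periodic-ℤ f a -[1+ j ] =
    trans (lem (f ⟨$⟩ (a + -[1+ j ] * + n)) +[1+ j ] (+ n))
    (cong (_+ -[1+ j ] * + n)
      (trans (sym (periodic-ℕ f _ (ℕ.suc j))) (cong (to f) (lem′ a +[1+ j ] (+ n)))))
    where
    lem : ∀ c i m → c ≡ c + i * m + (- i) * m
    lem = solve-∀
    lem′ : ∀ a i m → a + (- i) * m + i * m ≡ a
    lem′ = solve-∀

  to-injective : ∀ f {a b} → f ⟨$⟩ a ≡ f ⟨$⟩ b → a ≡ b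
  to-injective f {a} {b} eq =
    trans (sym (strictlyInverseʳ f a)) (trans (cong (from f) eq) (strictlyInverseʳ f b))

  InWindow : ℤ → Set
  InWindow a = 1ℤ ≤ᶻ a × a ≤ᶻ + n

  n≤+m*n : ∀ j → + n ≤ᶻ +[1+ j ] * + n
  n≤+m*n j = subst (_≤ᶻ +[1+ j ] * + n) (ℤ.*-identityˡ (+ n))
    (ℤ.*-monoʳ-≤-nonNeg (+ n) {1ℤ} {+[1+ j ]} (+≤+ (ℕ.s≤s ℕ.z≤n)))

  window-diff : ∀ {a b} → InWindow a → InWindow b → ∀ j → ¬ (a - b ≡ +[1+ j ] * + n)
  window-diff {a} {b} (_ , a≤n) (1≤b , _) j eq = ℤ.<⇒≱
    (≤-1⇒< (ℤ.+-mono-≤ a≤n (ℤ.neg-mono-≤ 1≤b)))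
    (subst (+ n ≤ᶻ_) (sym eq) (n≤+m*n j))

  window-≡ₙ : ∀ {a b} → InWindow a → InWindow b → a ≡ₙ b → a ≡ b
  window-≡ₙ {a} {b} wa wb (divides (+ 0) eq)      = ℤ.i-j≡0⇒i≡j a b eq
  window-≡ₙ {a} {b} wa wb (divides +[1+ j ] eq)   = ⊥-elim (window-diff wa wb j eq)
  window-≡ₙ {a} {b} wa wb (divides -[1+ j ] eq)   = ⊥-elim (window-diff wb wa j
    (trans (lem b a) (trans (cong (-_) eq) (ℤ.neg-distribˡ-* -[1+ j ] (+ n)))))
    where
    lem : ∀ b a → b - a ≡ - (a - b)
    lem = solve-∀

  -- By periodicity f(b) + mn = f(b + mn), so injectivity turns f(a) = f(b) + mn into a = b + mn.
  ≡ₙ-reflect : ∀ f a b → f ⟨$⟩ a ≡ₙ f ⟨$⟩ b → a ≡ₙ b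
  ≡ₙ-reflect f a b (divides m eq) = divides m
    (trans (cong (_- b) (to-injective f (trans fa≡ (sym (periodic-ℤ f b m))))) (lem b (m * + n)))
    where
    lem : ∀ b c → b + c - b ≡ c
    lem = solve-∀
    lem′ : ∀ c d → c ≡ d + (c - d)
    lem′ = solve-∀
    fa≡ : f ⟨$⟩ a ≡ f ⟨$⟩ b + m * + n
    fa≡ = trans (lem′ _ (f ⟨$⟩ b)) (cong (λ c → f ⟨$⟩ b + c) eq)

  ≡ₙ-joinʳ : ∀ a b c → a ≡ₙ c → b ≡ₙ c → a ≡ₙ b
  ≡ₙ-joinʳ a b c (divides p eq) (divides q eq′) = divides (p - q)
    (trans (lem a b c) (trans (cong₂ _-_ eq eq′) (lem′ p q (+ n))))
    where
    lem : ∀ a b c → a - b ≡ (a - c) - (b - c)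
    lem = solve-∀
    lem′ : ∀ p q m → p * m - q * m ≡ (p - q) * m
    lem′ = solve-∀

  -- Counting inversions

  swap-≥-1 : ∀ i a → a - 1ℤ ≤ᶻ swap i a
  swap-≥-1 i a with swap i a | swap-view i a
  ... | _ | up _ = ℤ.<⇒≤ (ℤ.<-trans (a-1<a a) (a<a+1 a))
  ... | _ | down = ℤ.≤-refl
  ... | _ | fix  = ℤ.<⇒≤ (a-1<a a)

  -- A swap moves every integer by at most 1, so a pair p < q is reversed only if p moves up and
  -- meets q at distance 1.
  swap-reverses : ∀ i {p q} → p <ᶻ q → swap i q <ᶻ swap i p → p ≡ₙ i × q ≡ p + 1ℤ
  swap-reverses i {p} {q} p<q lt = go (swap-view i p) (ℤ.≤-<-trans (swap-≥-1 i q) lt)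
    where
    go : ∀ {p′} → SwapView i p p′ → q - 1ℤ <ᶻ p′ → p ≡ₙ i × q ≡ p + 1ℤ
    go (up r) l = r , ℤ.≤-antisym (subst (_≤ᶻ p + 1ℤ) (-1+1 q) (<⇒+1≤ l)) (<⇒+1≤ p<q)
    go down   l = ⊥-elim (ℤ.<⇒≱ l (ℤ.+-monoˡ-≤ (- 1ℤ) (ℤ.<⇒≤ p<q)))
    go fix    l = ⊥-elim (ℤ.<⇒≱ l (<⇒≤-1 p<q))

  inversion-≡ : ∀ {f} {ι κ : Inversion f} → proj₁ ι ≡ proj₁ κ → ι ≡ κ
  inversion-≡ {f} {_ , (a , b) , c , d} {_ , (a′ , b′) , c′ , d′} refl
    rewrite ℤ.≤-irrelevant a a′ | ℤ.≤-irrelevant b b′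
          | ℤ.<-irrelevant c c′ | ℤ.<-irrelevant d d′ = refl

  -- An injection into `Fin r` bounds the number of inversions satisfying `P` without determining
  -- it. Such a bound passes to any smaller set of inversions and grows by at most one per letter.
  record AtMost (P : ℤ × ℤ → Set) (f : AffinePermutation) (r : ℕ) : Set where
    field
      index     : (ι : Inversion f) → P (proj₁ ι) → Fin r
      injective : ∀ ι κ p q → index ι p ≡ index κ q → proj₁ ι ≡ proj₁ κ

  open AtMost

  Any : ℤ × ℤ → Set
  Any _ = ⊤

  -- For an inversion (a , b), where 1 ≤ a < b, this puts both entries in the window 1, ..., n.
  Inner : ℤ × ℤ → Set
  Inner (_ , b) = b ≤ᶻ + n

  atMost-⊆ : ∀ {P f g r} →
    (∀ a b → InWindow a → a <ᶻ b → P (a , b) → g ⟨$⟩ b <ᶻ g ⟨$⟩ a → f ⟨$⟩ b <ᶻ f ⟨$⟩ a) →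
    AtMost P f r → AtMost P g r
  atMost-⊆ {P} {f} {g} ⊆ B = record
    { index     = λ ι p → index B (incl ι p) p
    ; injective = λ ι κ p q → injective B (incl ι p) (incl κ q) p q
    }
    where
    incl : (ι : Inversion g) → P (proj₁ ι) → Inversion f
    incl ((a , b) , w , a<b , lt) p = (a , b) , w , a<b , ⊆ a b w a<b p lt

  atMost-≈ : ∀ {P f g r} → f ≈ g → AtMost P f r → AtMost P g r
  atMost-≈ {f = f} {g} f≈g = atMost-⊆ {f = f} {g}
    λ a b _ _ _ → subst₂ _<ᶻ_ (sym (f≈g b)) (sym (f≈g a))

  increasing⇒atMost-0 : ∀ {P f} → (∀ a b → a <ᶻ b → f ⟨$⟩ a <ᶻ f ⟨$⟩ b) → AtMost P f 0
  increasing⇒atMost-0 {P} {f} inc = record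
    { index     = λ ι → ⊥-elim (none ι)
    ; injective = λ ι → ⊥-elim (none ι)
    }
    where
    none : Inversion f → ⊥
    none ((a , b) , _ , a<b , lt) = ℤ.<-asym lt (inc a b a<b)

  atMost⇒≤ : ∀ {P f l r} → HasLength f l → (∀ (ι : Inversion f) → P (proj₁ ι)) →
    AtMost P f r → l ≤ r
  atMost⇒≤ {f = f} h all B = injective⇒≤ {f = λ j → index B (Inverse.from h j) (all (Inverse.from h j))}
    λ {j} {j′} eq → trans (sym (Inverse.strictlyInverseˡ h j))
      (trans (cong (Inverse.to h) (inversion-≡ {f} (injective B _ _ _ _ eq)))
             (Inverse.strictlyInverseˡ h j′))

  -- A pair inverted by g ∙ s i but not by g is mapped by g to consecutive
  -- integers p ≡ i and p + 1; up to translation there is only one such pair.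
  atMost-∙s : ∀ {P g r} i → AtMost P g r → AtMost P (g ∙ s i) (ℕ.suc r)
  atMost-∙s {P} {g} {r} i B = record { index = idx ; injective = inj }
    where
    New : ℤ × ℤ → Set
    New (a , b) = g ⟨$⟩ a ≡ₙ + toℕ i × g ⟨$⟩ b ≡ g ⟨$⟩ a + 1ℤ

    split : ∀ a b → a <ᶻ b → (g ∙ s i) ⟨$⟩ b <ᶻ (g ∙ s i) ⟨$⟩ a →
            (g ⟨$⟩ b <ᶻ g ⟨$⟩ a) ⊎ New (a , b)
    split a b a<b lt with ℤ.<-cmp (g ⟨$⟩ b) (g ⟨$⟩ a)
    ... | tri< l _ _ = inj₁ l
    ... | tri≈ _ e _ = ⊥-elim (ℤ.<-irrefl (sym (to-injective g e)) a<b)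
    ... | tri> _ _ l = inj₂ (swap-reverses (+ toℕ i) l lt)

    idx : (ι : Inversion (g ∙ s i)) → P (proj₁ ι) → Fin (ℕ.suc r)
    idx ((a , b) , w , a<b , lt) p with split a b a<b lt
    ... | inj₁ l = suc (index B ((a , b) , w , a<b , l) p)
    ... | inj₂ _ = zero

    inj : ∀ ι κ p q → idx ι p ≡ idx κ q → proj₁ ι ≡ proj₁ κ
    inj ((a , b) , w , a<b , lt) ((a′ , b′) , w′ , a<b′ , lt′) p q eq
      with split a b a<b lt | split a′ b′ a<b′ lt′
    ... | inj₁ l | inj₁ l′ = injective B _ _ p q (suc-injective eq)
    -- For two new pairs, g(a) and g(a′) are both congruent to i, so a = a′ inside the window, and
    -- then g(b) = g(b′).
    ... | inj₂ (c , d) | inj₂ (c′ , d′) with window-≡ₙ w w′ 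
      (≡ₙ-reflect g a a′ (≡ₙ-joinʳ (g ⟨$⟩ a) (g ⟨$⟩ a′) (+ toℕ i) c c′))
    ... | refl = cong (a ,_) (to-injective g (trans d (sym d′)))

  -- The pair that s₀ could add is mapped to mn, mn + 1, hence it does not lie
  -- in one window.
  inner-∙s₀ : ∀ {g r} i → toℕ i ≡ 0 → Preserving g → AtMost Inner g r → AtMost Inner (g ∙ s i) r
  inner-∙s₀ {g} i i≡0 pg = atMost-⊆ {f = g} {g ∙ s i} old
    where
    old : ∀ a b → InWindow a → a <ᶻ b → Inner (a , b) →
          (g ∙ s i) ⟨$⟩ b <ᶻ (g ∙ s i) ⟨$⟩ a → g ⟨$⟩ b <ᶻ g ⟨$⟩ a
    old a b (1≤a , _) a<b b≤n lt with ℤ.<-cmp (g ⟨$⟩ b) (g ⟨$⟩ a)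
    ... | tri< l _ _ = l
    ... | tri≈ _ e _ = ⊥-elim (ℤ.<-irrefl (sym (to-injective g e)) a<b)
    ... | tri> _ _ l with swap-reverses (+ toℕ i) l lt
    -- Here g(a) = mn and g(b) = mn + 1. As g respects the boundary mn, this gives 1 ≤ a ≤ mn < b ≤
    -- n, which no m allows.
    ... | divides m eq , gb≡ = ⊥-elim (absurd m
            (proj₂ (pg m a) (ℤ.≤-reflexive ga≡))
            (ℤ.≰⇒> λ b≤ → ℤ.<⇒≱ (a<a+1 _)
              (subst₂ _≤ᶻ_ gb≡ (sym ga≡) (proj₁ (pg m b) b≤))))
      where
      ga≡ : g ⟨$⟩ a ≡ m * + n
      ga≡ = trans (sym (ℤ.+-identityʳ _))
                  (subst (λ i → g ⟨$⟩ a - + i ≡ m * + n) i≡0 eq)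
      absurd : ∀ m → a ≤ᶻ m * + n → m * + n <ᶻ b → ⊥
      absurd +[1+ j ] _    mn<b = ℤ.<⇒≱ mn<b (ℤ.≤-trans b≤n (n≤+m*n j))
      absurd (+ 0)    a≤mn _    = ℤ.<⇒≱ (+<+ (ℕ.s≤s ℕ.z≤n)) (ℤ.≤-trans 1≤a a≤mn)
      absurd -[1+ j ] a≤mn _    = ℤ.<⇒≱ (+<+ (ℕ.s≤s ℕ.z≤n)) (ℤ.≤-trans 1≤a (ℤ.≤-trans a≤mn
        (ℤ.*-monoʳ-≤-nonNeg (+ n) {(-[1+ j ])} {0ℤ} -≤+)))

  -- Reduced words

  atMost-∙word : ∀ {P g r} 𝐰 → AtMost P g r → AtMost P (g ∙ ⟦ 𝐰 ⟧) (length 𝐰 ℕ.+ r)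
  atMost-∙word {P} {g} [] B = atMost-≈ {f = g} {g ∙ ε} (λ _ → refl) B
  atMost-∙word {P} {g} {r} (i ∷ 𝐰) B = subst (AtMost P _) (ℕ.+-suc (length 𝐰) r)
    (atMost-≈ {f = (g ∙ s i) ∙ ⟦ 𝐰 ⟧} {g ∙ (s i ∙ ⟦ 𝐰 ⟧)} (λ _ → refl)
      (atMost-∙word {P} {g ∙ s i} 𝐰 (atMost-∙s {P} {g} i B)))

  AvoidsZero : Word → Set
  AvoidsZero = All λ i → 1 ≤ toℕ i

  -- Before the first s₀ the product preserves windows, so this s₀ adds no inner inversion, while
  -- every other letter adds at most one. A word containing s₀ therefore falls short of the bound by
  -- at least one.
  avoidsZero-or-shorter : ∀ {g r} 𝐰 → Preserving g → AtMost Inner g r →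
    AvoidsZero 𝐰 ⊎ ∃[ m ] (ℕ.suc m ≡ length 𝐰 ℕ.+ r × AtMost Inner (g ∙ ⟦ 𝐰 ⟧) m)
  avoidsZero-or-shorter [] pg B = inj₁ []
  avoidsZero-or-shorter {g} {r} (i ∷ 𝐰) pg B with 1 ℕ.≤? toℕ i
  ... | no 1≰i = inj₂ (length 𝐰 ℕ.+ r , refl ,
          atMost-≈ {f = (g ∙ s i) ∙ ⟦ 𝐰 ⟧} {g ∙ (s i ∙ ⟦ 𝐰 ⟧)} (λ _ → refl)
            (atMost-∙word {g = g ∙ s i} 𝐰 (inner-∙s₀ {g} i (ℕ.n≤0⇒n≡0 (ℕ.≮⇒≥ 1≰i)) pg B)))
  ... | yes 1≤i with avoidsZero-or-shorter {g ∙ s i} 𝐰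
                       (∙-preserving {g} {s i} pg (s-preserving i 1≤i)) (atMost-∙s {g = g} i B)
  ... | inj₁ all          = inj₁ (1≤i ∷ all)
  ... | inj₂ (m , eq , C) = inj₂ (m , trans eq (ℕ.+-suc (length 𝐰) r) ,
          atMost-≈ {f = (g ∙ s i) ∙ ⟦ 𝐰 ⟧} {g ∙ (s i ∙ ⟦ 𝐰 ⟧)} (λ _ → refl) C)

  -- If a ≤ n < b, then f(a) ≤ n < f(b), so the pair is not inverted.
  preserving⇒inner : ∀ f → Preserving f → (ι : Inversion f) → Inner (proj₁ ι)
  preserving⇒inner f pf ((a , b) , (_ , a≤n) , _ , lt) =
    ℤ.≮⇒≥ λ n<b → ℤ.<⇒≱
      (preserving-> f pf 1ℤ (subst (_<ᶻ b) (sym (ℤ.*-identityˡ (+ n))) n<b))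
      (ℤ.≤-trans (ℤ.<⇒≤ lt) (proj₁ (pf 1ℤ a) (subst (a ≤ᶻ_) (sym (ℤ.*-identityˡ (+ n))) a≤n)))

  -- All inversions of w are inner, so with an s₀ in the word there would be fewer of them than
  -- letters.
  reduced⇒avoidsZero : ∀ {w} 𝐰 → Preserving w → IsReducedWord 0 w 𝐰 → AvoidsZero 𝐰
  reduced⇒avoidsZero {w} 𝐰 pw (eq , len)
    with avoidsZero-or-shorter {ε} {0} 𝐰 ε-preserving (increasing⇒atMost-0 {f = ε} λ _ _ lt → lt)
  ... | inj₁ all          = all
  ... | inj₂ (m , e , C) = ⊥-elim (ℕ.1+n≰n (subst (_≤ m) (sym (trans e (ℕ.+-identityʳ _)))
          (atMost⇒≤ {f = w} len (preserving⇒inner w pw) (atMost-≈ {f = ε ∙ ⟦ 𝐰 ⟧} {w} eq C))))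

  -- Subwords

  ∏-preserving : ∀ 𝐰 u → AvoidsZero 𝐰 → IsSubword 𝐰 u → Preserving (∏ u)
  ∏-preserving []      u []         sub = ε-preserving
  ∏-preserving (i ∷ 𝐰) u (1≤i ∷ av) sub =
    ∙-preserving {u zero} {∏ (u ∘ suc)} (letter (sub zero)) (∏-preserving 𝐰 (u ∘ suc) av (sub ∘ suc))
    where
    letter : u zero ≈ s i ⊎ u zero ≈ ε → Preserving (u zero)
    letter (inj₁ eq) = ≈-preserving {s i} {u zero} (sym ∘ eq) (s-preserving i 1≤i)
    letter (inj₂ eq) = ≈-preserving {ε} {u zero} (sym ∘ eq) ε-preserving

  record Factorisation (f : AffinePermutation) (r : ℕ) : Set where
    field
      left right       : AffinePermutation
      product          : f ≈ left ∙ right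
      right-preserving : Preserving right
      left-bound       : AtMost Any left r

  open Factorisation

  -- Applied to an entry of a subword: `inj₁` marks a kept letter, `inj₂` a deleted one.
  weight : ∀ {A B : Set} → A ⊎ B → ℕ
  weight (inj₁ _) = 1
  weight (inj₂ _) = 0

  weight≤1 : ∀ {A B : Set} (c : A ⊎ B) → weight c ≤ 1
  weight≤1 (inj₁ _) = ℕ.≤-refl
  weight≤1 (inj₂ _) = ℕ.z≤n

  kept : ∀ 𝐱 𝐰 u → IsSubword (𝐱 ++ 𝐰) u → ℕ
  kept []      𝐰 u sub = 0
  kept (i ∷ 𝐱) 𝐰 u sub = weight (sub zero) ℕ.+ kept 𝐱 𝐰 (u ∘ suc) (sub ∘ suc)

  kept≤length : ∀ 𝐱 𝐰 u (sub : IsSubword (𝐱 ++ 𝐰) u) → kept 𝐱 𝐰 u sub ≤ length 𝐱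
  kept≤length []      𝐰 u sub = ℕ.z≤n
  kept≤length (i ∷ 𝐱) 𝐰 u sub = ℕ.+-mono-≤ (weight≤1 (sub zero)) (kept≤length 𝐱 𝐰 (u ∘ suc) (sub ∘ suc))

  -- The deleted letter at `j` contributes 0, and every other letter of 𝐱 at most 1.
  kept<length : ∀ 𝐱 𝐰 u (sub : IsSubword (𝐱 ++ 𝐰) u) j {u≈ε} → toℕ j < length 𝐱 →
    sub j ≡ inj₂ u≈ε → kept 𝐱 𝐰 u sub < length 𝐱
  kept<length (i ∷ 𝐱) 𝐰 u sub zero    _           eq rewrite eq = ℕ.s≤s (kept≤length 𝐱 𝐰 (u ∘ suc) (sub ∘ suc))
  kept<length (i ∷ 𝐱) 𝐰 u sub (suc j) (ℕ.s≤s j<) eq =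
    ℕ.+-mono-≤-< (weight≤1 (sub zero)) (kept<length 𝐱 𝐰 (u ∘ suc) (sub ∘ suc) j j< eq)

  atMost-∙letter : ∀ {P g r h} i (c : h ≈ s i ⊎ h ≈ ε) → AtMost P g r →
    AtMost P (g ∙ h) (weight c ℕ.+ r)
  atMost-∙letter {g = g} {h = h} i (inj₁ eq) B =
    atMost-≈ {f = g ∙ s i} {g ∙ h} (λ a → sym (eq _)) (atMost-∙s {g = g} i B)
  atMost-∙letter {g = g} {h = h} i (inj₂ eq) B =
    atMost-≈ {f = g} {g ∙ h} (λ a → sym (eq _)) B

  -- The accumulator `g` absorbs the entries taken from 𝐱 one by one, and only kept letters raise
  -- its bound. What remains at the end of 𝐱 comes from 𝐰 and forms `right`.
  factorise : ∀ {g r} 𝐱 𝐰 u → AvoidsZero 𝐰 → (sub : IsSubword (𝐱 ++ 𝐰) u) → AtMost Any g r →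
    Factorisation (g ∙ ∏ u) (kept 𝐱 𝐰 u sub ℕ.+ r)
  factorise {g} [] 𝐰 u av sub B = record
    { left = g ; right = ∏ u ; product = λ _ → refl
    ; right-preserving = ∏-preserving 𝐰 u av sub ; left-bound = B }
  factorise {g} {r} (i ∷ 𝐱) 𝐰 u av sub B = record
    { left = left F ; right = right F ; product = product F
    ; right-preserving = right-preserving F
    ; left-bound = subst (AtMost Any (left F)) (shuffle (kept 𝐱 𝐰 (u ∘ suc) (sub ∘ suc)) _ r) (left-bound F) }
    where
    F : Factorisation ((g ∙ u zero) ∙ ∏ (u ∘ suc)) (kept 𝐱 𝐰 (u ∘ suc) (sub ∘ suc) ℕ.+ (weight (sub zero) ℕ.+ r))
    F = factorise {g ∙ u zero} 𝐱 𝐰 (u ∘ suc) av (sub ∘ suc)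
          (atMost-∙letter {g = g} {h = u zero} i (sub zero) B)
    shuffle : ∀ a b c → a ℕ.+ (b ℕ.+ c) ≡ b ℕ.+ a ℕ.+ c
    shuffle a b c = trans (sym (ℕ.+-assoc a b c)) (cong (ℕ._+ c) (ℕ.+-comm a b))

  -- Powers of Λ have no inversions, so Λᵏ can start the accumulator of `factorise` with bound 0.
  Λ^-increasing : ∀ k a b → a <ᶻ b → (Λ ^ k) ⟨$⟩ a <ᶻ (Λ ^ k) ⟨$⟩ b
  Λ^-increasing ℕ.zero    a b lt = lt
  Λ^-increasing (ℕ.suc k) a b lt = Λ^-increasing k _ _ (ℤ.+-monoˡ-< 1ℤ lt)

  -- Minimality of x_w in its coset

  -- As k ≤ n, the residues 1, ..., k lie in the window themselves, so there congruence to one of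
  -- them is equality.
  inFirst⇒≤ : ∀ {k p} → k ≤ n → InWindow p → InFirst k p → p ≤ᶻ + k
  inFirst⇒≤ {k} {p} k≤n wp (j , p≡) = subst (_≤ᶻ + k)
    (sym (window-≡ₙ wp (+≤+ (ℕ.s≤s ℕ.z≤n) , +≤+ (ℕ.≤-trans (toℕ<n j) k≤n)) p≡))
    (+≤+ (toℕ<n j))

  ¬inFirst⇒> : ∀ {k p} → InWindow p → ¬ InFirst k p → + k <ᶻ p
  ¬inFirst⇒> {k} {+[1+ p ]} wp ∉ = ℤ.≰⇒> λ { (+≤+ p<k) → ∉ (fromℕ< p<k ,
    divides 0ℤ (ℤ.i≡j⇒i-j≡0 (cong +[1+_] (sym (toℕ-fromℕ< p<k))))) }
  ¬inFirst⇒> {p = + 0} (+≤+ () , _) _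

  module _ {k : ℕ} (k≤n : k ≤ n) {w : AffinePermutation}
           (pw : Preserving w) (gr : IsGrassmannian k w) where

    w-n : ∀ p → w ⟨$⟩ (p - + n) ≡ w ⟨$⟩ p - + n
    w-n p = subst (λ c → w ⟨$⟩ (p + c) ≡ w ⟨$⟩ p + c) (ℤ.-1*i≡-i (+ n)) (periodic-ℤ w p (- 1ℤ))

    from-x-increasing₁ : ∀ {p q} → InWindow p → InWindow q → p <ᶻ q → from (x k w) p <ᶻ from (x k w) q
    from-x-increasing₁ {p} {q} wp wq p<q with inFirst? k p | inFirst? k q
    ... | yes c | yes d = subst₂ _<ᶻ_ (sym (w-n p)) (sym (w-n q))
            (ℤ.+-monoˡ-< (- + n) (proj₁ gr p q (proj₁ wp) p<q (inFirst⇒≤ k≤n wq d)))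
    -- Here p - n ≤ 0 < q, and w respects the boundary 0, so w(p - n) ≤ 0 < w(q).
    ... | yes c | no d  = ℤ.≤-<-trans
            (proj₁ (pw 0ℤ (p - + n)) (ℤ.i≤j⇒i-j≤0 (proj₂ wp)))
            (preserving-> w pw 0ℤ (ℤ.<-≤-trans (+<+ (ℕ.s≤s ℕ.z≤n)) (proj₁ wq)))
    ... | no c  | yes d = ⊥-elim (ℤ.<-asym p<q (ℤ.≤-<-trans (inFirst⇒≤ k≤n wq d) (¬inFirst⇒> wp c)))
    ... | no c  | no d  = proj₂ gr p q (<⇒+1≤ (¬inFirst⇒> wp c)) p<q (proj₂ wq)

    -- Translation by -mn carries this window to 1, ..., n and commutes with the inverse of x_w.
    from-x-increasing : ∀ m {p q} → m * + n <ᶻ p → p <ᶻ q → q ≤ᶻ sucᶻ m * + n →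
      from (x k w) p <ᶻ from (x k w) q
    from-x-increasing m {p} {q} mn<p p<q q≤ = subst₂ _<ᶻ_ (translate p) (translate q)
      (ℤ.+-monoˡ-< (m * + n) (from-x-increasing₁
        (lower mn<p , upper (ℤ.<⇒≤ (ℤ.<-≤-trans p<q q≤)))
        (lower (ℤ.<-trans mn<p p<q) , upper q≤)
        (ℤ.+-monoˡ-< (- (m * + n)) p<q)))
      where
      lem : ∀ c → c + 1ℤ - c ≡ 1ℤ
      lem = solve-∀
      lem′ : ∀ m d → (1ℤ + m) * d - m * d ≡ d
      lem′ = solve-∀
      lower : ∀ {c} → m * + n <ᶻ c → 1ℤ ≤ᶻ c - m * + n
      lower {c} lt = subst (_≤ᶻ c - m * + n) (lem (m * + n)) (ℤ.+-monoˡ-≤ (- (m * + n)) (<⇒+1≤ lt))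
      upper : ∀ {c} → c ≤ᶻ sucᶻ m * + n → c - m * + n ≤ᶻ + n
      upper {c} le = subst (c - m * + n ≤ᶻ_) (lem′ m (+ n)) (ℤ.+-monoˡ-≤ (- (m * + n)) le)
      translate : ∀ c → from (x k w) (c - m * + n) + m * + n ≡ from (x k w) c
      translate c = trans (sym (periodic-ℤ (x k w ⁻¹) (c - m * + n) m))
                          (cong (from (x k w)) (-n+n c (m * + n)))

    -- If both images lay in one window, monotonicity of the inverse there would give b < a. So some
    -- boundary mn separates them, and z keeps each image on its side.
    x-inversion-persists : ∀ {z} → Preserving z → ∀ {a b} → a <ᶻ b →
      x k w ⟨$⟩ b <ᶻ x k w ⟨$⟩ a → (x k w ∙ z) ⟨$⟩ b <ᶻ (x k w ∙ z) ⟨$⟩ a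
    x-inversion-persists {z} pz {a} {b} a<b lt = ℤ.≤-<-trans
      (proj₁ (pz m p) (ℤ.≮⇒≥ λ mn<p → ℤ.<-asym a<b
        (subst₂ _<ᶻ_ (strictlyInverseʳ (x k w) b) (strictlyInverseʳ (x k w) a)
          (from-x-increasing m mn<p lt q≤))))
      (preserving-> z pz m mn<q)
      where
      p q m : ℤ
      p = x k w ⟨$⟩ b
      q = x k w ⟨$⟩ a
      -- Windows begin at mn + 1, so dividing q - 1 by n yields mn < q ≤ (m + 1)n.
      m = (q - 1ℤ) /ℕ n
      mn<q : m * + n <ᶻ q
      mn<q = ≤-1⇒< ([n/ℕd]*d≤n (q - 1ℤ) n)
      q≤ : q ≤ᶻ sucᶻ m * + n
      q≤ = subst (_≤ᶻ sucᶻ m * + n) (-1+1 q) (<⇒+1≤ (n<s[n/ℕd]*d (q - 1ℤ) n))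

    x-minimal : ∀ {l r z} → HasLength (x k w) l → Preserving z → AtMost Any (x k w ∙ z) r → l ≤ r
    x-minimal {z = z} len pz B = atMost⇒≤ {f = x k w} len (λ _ → tt)
      (atMost-⊆ {f = x k w ∙ z} {x k w} (λ _ _ _ a<b _ → x-inversion-persists {z} pz a<b) B)

lemma3p10 : (n k : ℕ) (2≤n : 2 ≤ n) (k≤n : k ≤ n) →
    let open Affine n 2≤n in
    (v w : AffinePermutation) → InSₙ v → InSₙ w →
    v ≤ᴮ w → IsGrassmannian k w →
    (𝐱 𝐰 : Word) → IsReducedWord k (x k w) 𝐱 → IsReducedWord 0 w 𝐰 →
    (u : Vector AffinePermutation (length (𝐱 ++ 𝐰))) →
    IsSubwordFor k (x k w ∙ v) (𝐱 ++ 𝐰) u →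
    (ℓ : ℕ) → HasLength (x k w) ℓ →
    (j : Fin (length (𝐱 ++ 𝐰))) → toℕ j < ℓ →
    u j ≈ s (lookup (𝐱 ++ 𝐰) j)
lemma3p10 n k 2≤n k≤n v w v∈Sₙ w∈Sₙ _ gr 𝐱 𝐰 (_ , len𝐱) red𝐰 u (sub , ∏u≈) ℓ lenℓ j j<ℓ
  with sub j in eq
... | inj₁ uj≈s = uj≈s
-- Deleting this letter leaves fewer than ℓ(x_w) letters of 𝐱, too few to reach the coset of x_w.
... | inj₂ uj≈ε = ⊥-elim (ℕ.<⇒≱ (kept<length 𝐱 𝐰 u sub j j<length eq)
        (subst (length 𝐱 ≤_) (ℕ.+-identityʳ _)
          (x-minimal k≤n {w} pw gr {z = z} len𝐱 pz (atMost-≈ {f = left F} {x k w ∙ z} left≈ (left-bound F)))))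
  where
  open Affine n 2≤n
  open AffinePermutation
  open Factorisation
  pw : Preserving w
  pw = Sₙ-preserving w∈Sₙ
  j<length : toℕ j < length 𝐱
  -- `ℓ` and `length 𝐱` both count the inversions of x_w.
  j<length = subst (toℕ j <_) (↔⇒≡ (len𝐱 ↔-∘ ↔-sym lenℓ)) j<ℓ
  F : Factorisation ((Λ ^ k) ∙ ∏ u) (kept 𝐱 𝐰 u sub ℕ.+ 0)
  F = factorise {g = Λ ^ k} 𝐱 𝐰 u (reduced⇒avoidsZero {w = w} 𝐰 pw red𝐰) sub
        (increasing⇒atMost-0 {f = Λ ^ k} (Λ^-increasing k))
  z : AffinePermutation
  z = v ∙ right F ⁻¹
  pz : Preserving z
  pz = ∙-preserving {f = v} {right F ⁻¹} (Sₙ-preserving v∈Sₙ) (⁻¹-preserving {f = right F} (right-preserving F))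
  -- The subword equation, multiplied on the left by Λᵏ, reads `left F` ∙ `right F` = x_w v.
  -- Cancelling `right F` on the right gives the claim.
  left≈ : left F ≈ x k w ∙ z
  left≈ a = trans (sym (strictlyInverseʳ (right F) (left F ⟨$⟩ a)))
    (cong (from (right F)) (trans (sym (product F a))
      (trans (∏u≈ ((Λ ^ k) ⟨$⟩ a)) (cong (to (x k w ∙ v)) (strictlyInverseʳ (Λ ^ k) a)))))
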